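{- Let $\Delta$ be a $d$-dimensional simplicial complex. (1) If $\Delta$ is skeleton-E-chordal, then either $\Delta$ is a vertex neighborhood (i.e. $\Delta=N(v,\Delta)$ for some vertex $v$), or it splits as $\Delta=\Delta_1\cup\Delta_2$, where $\Delta_1$ and $\Delta_2$ are proper skeleton-E-chordal subcomplexes of $\Delta$, and $\Delta_1\cap\Delta_2$ is a complex whose $1$-skeleton is a clique. (2) Suppose $\Delta$ splits as $\Delta=\Delta_1\cup\Delta_2$, where each $\Delta_i$ is a proper skeleton-clique-chordal subcomplex of $\Delta$, and $\Delta_1\cap\Delta_2$ is a complex whose $1$-skeleton is a clique. Then $\Delta$ is skeleton-clique-chordal.
   Context: Simplicial complexes are finite and not necessarily pure. A "clique" as a $1$-skeleton means a complete graph. The neighborhood $N(v,\Delta)$ of a vertex $v$ is the complex obtained from $\Delta$ by deleting all vertices that are neither $v$ nor connected by an edge to $v$ (i.e. the induced subcomplex on $v$ and its neighbors). A vertex labeling of a complex with $n$ vertices is a bijection of its vertices with $[n]$; $\max f$ is the largest label in $f$; the size of a face is its number of vertices. A complex $\Gamma$ is skeleton-E-chordal if it has a vertex labeling such that for every two faces $f\neq g$ of $\Gamma$ with the same size and the same maximum, every subset $h\subseteq f\cup g$ with $|h|=|f|$ is a face of $\Gamma$. $\Gamma$ is skeleton-clique-chordal if it has a vertex labeling such that for every two faces $f\ne g$ of $\Gamma$ with the same size $\ge 2$ and the same maximum, every $2$-element subset of $f\cup g$ is a face of $\Gamma$. -}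

module Defs where

open import Data.Fin.Base as Fin using (Fin)
import Data.Fin.Properties as Fin
open import Data.Fin.Subset as Subset using (Subset; ⊥; ⁅_⁆; ∣_∣)
open import Data.Fin.Subset.Properties using (∉⊥; ∣⊥∣≡0; p⊆q⇒∣p∣≤∣q∣; Lift?)
open import Data.Nat.Base using (ℕ; suc; _≤_; z≤n)
open import Data.Nat.Properties using (≤-trans; _≤?_)
open import Data.Product.Base using (∃; _×_; _,_)
open import Data.Refinement.Base using (Refinement-syntax; value)
open import Data.Sum.Base as Sum using (_⊎_; inj₁)
open import Function.Bundles using (_⤖_; Bijection)
open import Level using (0ℓ)
open import Relation.Binary.PropositionalEquality using (_≡_; _≢_; sym; subst)
open import Relation.Nullary.Decidable using (¬?; _×-dec_; _⊎-dec_)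
open import Relation.Unary using (Pred; Decidable; _≐_)
import Relation.Unary as Unary
open import Relation.Nullary.Negation.Core using (contradiction)

-- Finite simplicial complexes with vertices among the points of Fin N. Not
-- every point need be a vertex, so a complex and its subcomplexes (which may
-- have fewer vertices) share the same N. The empty set is always a face.
record Complex (N : ℕ) : Set₁ where
  field
    Face        : Pred (Subset N) 0ℓ
    Face?       : Decidable Face
    Face-⊥      : Face ⊥
    Face-closed : ∀ {s t} → s Subset.⊆ t → Face t → Face s

open Complex public using (Face; Face?; Face-⊥; Face-closed)

-- The proof of being a vertex is irrelevant, so that vertices are equal
-- exactly when the underlying points are.
Vertex : ∀ {N} → Complex N → Set
Vertex {N} Δ = [ v ∈ Fin N ∣ Face Δ ⁅ v ⁆ ]

Adjacent : ∀ {N} → Complex N → Fin N → Fin N → Set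
Adjacent Δ u v = u ≢ v × Face Δ (⁅ u ⁆ Subset.∪ ⁅ v ⁆)

HasDimension : ∀ {N} → Complex N → ℕ → Set
HasDimension Δ d =
  (∃ λ s → Face Δ s × ∣ s ∣ ≡ suc d) × (∀ s → Face Δ s → ∣ s ∣ ≤ suc d)

infix 4 _≈_ _⊂_
infixr 7 _∩_
infixr 6 _∪_

_≈_ : ∀ {N} → Complex N → Complex N → Set
Γ ≈ Δ = Face Γ ≐ Face Δ

_⊂_ : ∀ {N} → Complex N → Complex N → Set
Γ ⊂ Δ = Face Γ Unary.⊂ Face Δ

_∪_ : ∀ {N} → Complex N → Complex N → Complex N
Γ ∪ Δ = record
  { Face        = Face Γ Unary.∪ Face Δ
  ; Face?       = λ s → Face? Γ s ⊎-dec Face? Δ s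
  ; Face-⊥      = inj₁ (Face-⊥ Γ)
  ; Face-closed = λ s⊆t → Sum.map (Face-closed Γ s⊆t) (Face-closed Δ s⊆t)
  }

_∩_ : ∀ {N} → Complex N → Complex N → Complex N
Γ ∩ Δ = record
  { Face        = Face Γ Unary.∩ Face Δ
  ; Face?       = λ s → Face? Γ s ×-dec Face? Δ s
  ; Face-⊥      = Face-⊥ Γ , Face-⊥ Δ
  ; Face-closed = λ s⊆t (p , q) → Face-closed Γ s⊆t p , Face-closed Δ s⊆t q
  }

induced : ∀ {N} → Complex N → {P : Pred (Fin N) 0ℓ} → Decidable P → Complex N
induced Δ {P} P? = record
  { Face        = λ s → Face Δ s × Subset.Lift P s
  ; Face?       = λ s → Face? Δ s ×-dec Lift? P? s
  ; Face-⊥      = Face-⊥ Δ , λ x∈⊥ → contradiction x∈⊥ ∉⊥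
  ; Face-closed = λ s⊆t (p , q) → Face-closed Δ s⊆t p , λ x∈s → q (s⊆t x∈s)
  }

neighbourhood : ∀ {N} (Δ : Complex N) → Vertex Δ → Complex N
neighbourhood Δ v = induced Δ {λ x → x ≡ value v ⊎ Adjacent Δ x (value v)} λ x →
  (x Fin.≟ value v) ⊎-dec
  (¬? (x Fin.≟ value v) ×-dec Face? Δ (⁅ x ⁆ Subset.∪ ⁅ value v ⁆))

skeleton : ∀ {N} → ℕ → Complex N → Complex N
skeleton {N} k Δ = record
  { Face        = λ s → Face Δ s × ∣ s ∣ ≤ suc k
  ; Face?       = λ s → Face? Δ s ×-dec (∣ s ∣ ≤? suc k)
  ; Face-⊥      = Face-⊥ Δ , subst (_≤ suc k) (sym (∣⊥∣≡0 N)) z≤n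
  ; Face-closed = λ s⊆t (p , q) →
      Face-closed Δ s⊆t p , ≤-trans (p⊆q⇒∣p∣≤∣q∣ s⊆t) q
  }

-- The graph without vertices counts as complete.
IsCompleteGraph : ∀ {N} → Complex N → Set
IsCompleteGraph Γ =
  (∀ s → Face Γ s → ∣ s ∣ ≤ 2) ×
  (∀ (u v : Vertex Γ) → u ≢ v → Adjacent Γ (value u) (value v))

-- The number n is necessarily the number of vertices of Δ.
Labeling : ∀ {N} → Complex N → ℕ → Set
Labeling Δ n = Vertex Δ ⤖ Fin n

module _ {N n : ℕ} (Δ : Complex N) (ℓ : Labeling Δ n) where

  open Bijection ℓ using () renaming (to to label)

  -- All points of a face are vertices, so on faces m is the largest label.
  IsMax : Subset N → Fin n → Set
  IsMax f m =
    (∃ λ (v : Vertex Δ) → value v Subset.∈ f × label v ≡ m) ×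
    (∀ (v : Vertex Δ) → value v Subset.∈ f → label v Fin.≤ m)

  SameMax : Subset N → Subset N → Set
  SameMax f g = ∃ λ m → IsMax f m × IsMax g m

SkeletonEChordal : ∀ {N} → Complex N → Set
SkeletonEChordal Δ = ∃ λ n → ∃ λ (ℓ : Labeling Δ n) →
  ∀ f g → Face Δ f → Face Δ g → f ≢ g → ∣ f ∣ ≡ ∣ g ∣ → SameMax Δ ℓ f g →
  ∀ h → h Subset.⊆ f Subset.∪ g → ∣ h ∣ ≡ ∣ f ∣ → Face Δ h

SkeletonCliqueChordal : ∀ {N} → Complex N → Set
SkeletonCliqueChordal Δ = ∃ λ n → ∃ λ (ℓ : Labeling Δ n) →
  ∀ f g → Face Δ f → Face Δ g → f ≢ g → ∣ f ∣ ≡ ∣ g ∣ → 2 ≤ ∣ f ∣ →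
  SameMax Δ ℓ f g →
  ∀ h → h Subset.⊆ f Subset.∪ g → ∣ h ∣ ≡ 2 → Face Δ h

SplitsAs : ∀ {N} → Complex N → Complex N → Complex N → Set
SplitsAs Δ Δ₁ Δ₂ =
  Δ ≈ Δ₁ ∪ Δ₂ × Δ₁ ⊂ Δ × Δ₂ ⊂ Δ × IsCompleteGraph (skeleton 1 (Δ₁ ∩ Δ₂))

{-# OPTIONS --safe #-}

-- (1) Let v be the vertex with the largest label. Any face avoids v or lies in
-- N(v), so Δ = (Δ - v) ∪ N(v), and two neighbours a, b of v are adjacent because
-- the edges av and bv have the same maximum. Induced subcomplexes inherit
-- skeleton-E-chordality.
--
-- (2) Skeleton-clique-chordality says exactly that the labels form a perfect
-- elimination order of the 1-skeleton: the smaller neighbours of each vertex are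
-- pairwise adjacent. In a graph with such an order every clique that misses a
-- vertex misses a simplicial vertex. So the vertices of Δ₂ outside Δ₁ can be
-- removed one at a time, each simplicial when removed; putting them back above an
-- order for Δ₁ gives an order for Δ.
module Submission where

open import Defs
open import Data.Empty using (⊥-elim)
open import Data.Fin.Base as Fin using (Fin; zero; suc; toℕ; fromℕ; opposite)
import Data.Fin.Properties as Fin
open import Data.Fin.Subset as Subset using (Subset; inside; outside; ⁅_⁆; ∣_∣)
open import Data.Fin.Subset.Properties
  using (x∈⁅x⁆; x∈⁅y⁆⇒x≡y; ∣⁅x⁆∣≡1; ∪-comm; ∪-identityˡ; ∪-identityʳ; x∈p∪q⁻; x∈p∪q⁺; _∈?_)
open import Data.List.Base using (List; []; _∷_; length; lookup; map; tabulate; filter)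
open import Data.List.Membership.Propositional using (_∈_; _∉_; find; lose)
open import Data.List.Membership.Propositional.Properties
  using (∈-filter⁺; ∈-filter⁻; ∈-lookup; ∈-tabulate⁺; ∈-map⁺; ∈-map⁻)
open import Data.List.Properties using (filter-notAll)
open import Data.List.Relation.Unary.All as All using (All; []; _∷_)
open import Data.List.Relation.Unary.All.Properties using (¬All⇒Any¬)
open import Data.List.Relation.Unary.AllPairs using (AllPairs; []; _∷_)
import Data.List.Relation.Unary.AllPairs.Properties as AllPairs
open import Data.List.Relation.Unary.Any using (here; there; index)
open import Data.List.Relation.Unary.Any.Properties using (lookup-index)
open import Data.Irrelevant using ([_])
open import Data.Nat.Base using (ℕ; zero; suc; _≤_; _<_; z≤n; s≤s; s<s⁻¹)
open import Data.Nat.Induction using (<-wellFounded)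
import Data.Nat.Properties as ℕ
open import Data.Product.Base using (∃; ∃₂; _×_; _,_; proj₁; proj₂)
open import Data.Refinement.Base using (value; _,_)
open import Data.Refinement.Properties using (value-injective)
open import Data.Sum.Base using (_⊎_; inj₁; inj₂; [_,_]′)
open import Data.Vec.Base as Vec using ([]; _∷_)
open import Function.Base using (_∘_; case_of_)
open import Function.Bundles using (Bijection; mk⤖)
open import Function.Definitions using (Injective)
open import Induction.WellFounded using (Acc; acc)
open import Level using (0ℓ)
open import Relation.Binary.Core using (Rel)
open import Relation.Binary.Definitions using (tri<; tri≈; tri>)
import Relation.Binary.Definitions as Binary
open import Relation.Binary.PropositionalEquality
  using (_≡_; _≢_; refl; sym; trans; cong; subst; subst₂)
open import Relation.Nullary using (¬_; yes; no; contradiction)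
open import Relation.Nullary.Decidable using (recompute; ¬?; _×-dec_; _⊎-dec_; _→-dec_)
open import Relation.Unary using (Pred; Decidable)

private
  variable
    N n : ℕ
    A : Set

-- Subsets with at most two elements.

pair : Fin N → Fin N → Subset N
pair u v = ⁅ u ⁆ Subset.∪ ⁅ v ⁆

∈-pairˡ : (u v : Fin N) → u Subset.∈ pair u v
∈-pairˡ u v = x∈p∪q⁺ (inj₁ (x∈⁅x⁆ u))

∈-pairʳ : (u v : Fin N) → v Subset.∈ pair u v
∈-pairʳ u v = x∈p∪q⁺ (inj₂ (x∈⁅x⁆ v))

∈-pair⁻ : ∀ {x u v : Fin N} → x Subset.∈ pair u v → x ≡ u ⊎ x ≡ v
∈-pair⁻ {u = u} {v} x∈ =
  [ inj₁ ∘ x∈⁅y⁆⇒x≡y u , inj₂ ∘ x∈⁅y⁆⇒x≡y v ]′ (x∈p∪q⁻ ⁅ u ⁆ ⁅ v ⁆ x∈)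

⁅⁆⊆ : ∀ {u : Fin N} {s} → u Subset.∈ s → ⁅ u ⁆ Subset.⊆ s
⁅⁆⊆ {u = u} {s} u∈s x∈ = subst (Subset._∈ s) (sym (x∈⁅y⁆⇒x≡y u x∈)) u∈s

pair⊆ : ∀ {u v : Fin N} {s} → u Subset.∈ s → v Subset.∈ s → pair u v Subset.⊆ s
pair⊆ u∈s v∈s x∈ with ∈-pair⁻ x∈
... | inj₁ refl = u∈s
... | inj₂ refl = v∈s

∣pair∣≡2 : ∀ {u v : Fin N} → u ≢ v → ∣ pair u v ∣ ≡ 2
∣pair∣≡2 {u = zero}  {zero}  u≢v = contradiction refl u≢v
∣pair∣≡2 {u = zero}  {suc v} u≢v =
  cong suc (trans (cong ∣_∣ (∪-identityˡ ⁅ v ⁆)) (∣⁅x⁆∣≡1 v))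
∣pair∣≡2 {u = suc u} {zero}  u≢v =
  cong suc (trans (cong ∣_∣ (∪-identityʳ ⁅ u ⁆)) (∣⁅x⁆∣≡1 u))
∣pair∣≡2 {u = suc u} {suc v} u≢v = ∣pair∣≡2 (u≢v ∘ cong suc)

∣p∣≡0⇒p≡⊥ : (p : Subset N) → ∣ p ∣ ≡ 0 → p ≡ Subset.⊥
∣p∣≡0⇒p≡⊥ []            _  = refl
∣p∣≡0⇒p≡⊥ (outside ∷ p) eq = cong (outside ∷_) (∣p∣≡0⇒p≡⊥ p eq)

∣p∣≡1⇒p≡⁅x⁆ : (p : Subset N) → ∣ p ∣ ≡ 1 → ∃ λ x → p ≡ ⁅ x ⁆
∣p∣≡1⇒p≡⁅x⁆ (inside ∷ p) eq =
  zero , cong (inside ∷_) (∣p∣≡0⇒p≡⊥ p (ℕ.suc-injective eq))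
∣p∣≡1⇒p≡⁅x⁆ (outside ∷ p) eq with x , refl ← ∣p∣≡1⇒p≡⁅x⁆ p eq = suc x , refl

∣p∣≡2⇒p≡pair : (p : Subset N) → ∣ p ∣ ≡ 2 → ∃₂ λ x y → x ≢ y × p ≡ pair x y
∣p∣≡2⇒p≡pair (inside ∷ p) eq
  with x , refl ← ∣p∣≡1⇒p≡⁅x⁆ p (ℕ.suc-injective eq) =
  zero , suc x , (λ ()) , cong (inside ∷_) (sym (∪-identityˡ ⁅ x ⁆))
∣p∣≡2⇒p≡pair (outside ∷ p) eq
  with x , y , x≢y , refl ← ∣p∣≡2⇒p≡pair p eq =
  suc x , suc y , x≢y ∘ Fin.suc-injective , refl

member : (s : Subset N) → 1 ≤ ∣ s ∣ → ∃ λ x → x Subset.∈ s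
member (inside  ∷ s) _ = zero , Vec.here
member (outside ∷ s) p with x , x∈s ← member s p = suc x , Vec.there x∈s

-- Sorted lists and reversed indices.

lookup-AllPairs : {R : Rel A 0ℓ} {xs : List A} → AllPairs R xs →
  ∀ {i j} → i Fin.< j → R (lookup xs i) (lookup xs j)
lookup-AllPairs (r ∷ _)  {zero}  {suc j} _   = All.lookup r (∈-lookup j)
lookup-AllPairs (_ ∷ rs) {suc i} {suc j} i<j = lookup-AllPairs rs (s<s⁻¹ i<j)

<⇒≢⇒injective : {f : Fin n → A} → (∀ {i j} → i Fin.< j → f i ≢ f j) →
  Injective _≡_ _≡_ f
<⇒≢⇒injective f≢ {i} {j} eq with Fin.<-cmp i j
... | tri< i<j _ _ = contradiction eq (f≢ i<j)
... | tri≈ _ i≡j _ = i≡j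
... | tri> _ _ j<i = contradiction (sym eq) (f≢ j<i)

opposite-antitone : {i j : Fin n} → i Fin.< j → opposite j Fin.< opposite i
opposite-antitone {i = i} {j} i<j =
  subst₂ _<_ (sym (Fin.opposite-prop j)) (sym (Fin.opposite-prop i))
    (ℕ.∸-monoʳ-< (s≤s i<j) (Fin.toℕ<n j))

-- Perfect elimination orders

-- The point `x` may lie in `xs` or not, so the notion serves both for the head of an order over its
-- tail and for a vertex inside a list.
Simplicial : Rel A 0ℓ → List A → A → Set
Simplicial E xs x = ∀ {a b} → a ∈ xs → b ∈ xs → E a x → E b x → a ≢ b → E a b

-- The list starts with the vertex of largest label.
data PEO {A : Set} (E : Rel A 0ℓ) : List A → Set where
  []  : PEO E []
  _∷_ : ∀ {x xs} → x ∉ xs × Simplicial E xs x → PEO E xs → PEO E (x ∷ xs)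

-- Deleting vertices only shrinks the set of later neighbours of those that remain.
PEO-filter : {E : Rel A 0ℓ} {P : Pred A 0ℓ} (P? : Decidable P) → ∀ {xs} →
  PEO E xs → PEO E (filter P? xs)
PEO-filter P? [] = []
PEO-filter P? {x ∷ xs} ((x∉ , simp) ∷ peo) with P? x
... | no  _ = PEO-filter P? peo
... | yes _ = (x∉ ∘ old , λ a∈ b∈ → simp (old a∈) (old b∈)) ∷ PEO-filter P? peo
  where old : ∀ {y} → y ∈ filter P? xs → y ∈ xs
        old = proj₁ ∘ ∈-filter⁻ P?

PEO⇒unique : {E : Rel A 0ℓ} → ∀ {xs} → PEO E xs → AllPairs _≢_ xs
PEO⇒unique [] = []
PEO⇒unique ((x∉ , _) ∷ peo) =
  All.tabulate (λ y∈ x≡y → x∉ (subst (_∈ _) (sym x≡y) y∈)) ∷ PEO⇒unique peo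

-- The entries are variables tied by equations, so that underlying points of labeled vertices can be
-- supplied for them.
PEO-lookup : {E : Rel A 0ℓ} → ∀ {xs} → PEO E xs → ∀ {i j k x a b} →
  lookup xs i ≡ x → lookup xs j ≡ a → lookup xs k ≡ b → i Fin.< j → i Fin.< k →
  E a x → E b x → a ≢ b → E a b
PEO-lookup ((_ , simp) ∷ _) {zero} {suc j} {suc k} refl refl refl _ _ =
  simp (∈-lookup j) (∈-lookup k)
PEO-lookup (_ ∷ peo) {suc i} {suc j} {suc k} i≡x j≡a k≡b i<j i<k =
  PEO-lookup peo i≡x j≡a k≡b (s<s⁻¹ i<j) (s<s⁻¹ i<k)

-- This carries an order from a subcomplex to the whole complex: `F` may have more edges than `E`,
-- but none between listed points.
PEO-resp : {E F : Rel A 0ℓ} → (∀ {a b} → E a b → F a b) → ∀ {xs} →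
  (∀ {a b} → a ∈ xs → b ∈ xs → F a b → E a b) → PEO E xs → PEO F xs
PEO-resp E⊆F F⊆E [] = []
PEO-resp E⊆F F⊆E ((x∉ , simp) ∷ peo) =
  (x∉ , λ a∈ b∈ ax bx a≢b →
    E⊆F (simp a∈ b∈ (F⊆E (there a∈) (here refl) ax) (F⊆E (there b∈) (here refl) bx) a≢b))
  ∷ PEO-resp E⊆F (λ a∈ b∈ → F⊆E (there a∈) (there b∈)) peo

-- Simplicial vertices and gluing of orders.

module Elimination (_≟_ : Binary.DecidableEquality A)
                   (E : Rel A 0ℓ) (E? : Binary.Decidable E)
                   (irrefl : ∀ {x} → ¬ E x x) (symm : ∀ {x y} → E x y → E y x) where

  simplicial-extend : ∀ {v xs s} → ¬ E s v → Simplicial E xs s → Simplicial E (v ∷ xs) s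
  simplicial-extend ¬sv simp (here refl) _           av _  _ = contradiction (symm av) ¬sv
  simplicial-extend ¬sv simp (there _)   (here refl) _  bv _ = contradiction (symm bv) ¬sv
  simplicial-extend ¬sv simp (there a∈)  (there b∈)          = simp a∈ b∈

  -- If the first vertex v lies in K, then K consists of v and neighbours of v, and
  -- the induction hypothesis is applied to the clique of all neighbours of v.
  simplicial-outside-clique : ∀ {xs} → PEO E xs → {K : Pred A 0ℓ} → Decidable K →
    (∀ {a b} → a ∈ xs → b ∈ xs → K a → K b → a ≢ b → E a b) →
    ∀ {x} → x ∈ xs → ¬ K x → ∃ λ s → s ∈ xs × ¬ K s × Simplicial E xs s
  simplicial-outside-clique {v ∷ xs} ((v∉ , simp) ∷ peo) {K} K? clique {x} x∈ ¬Kx with K? v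
  -- By irreflexivity `v` is not its own neighbour, so it stays simplicial when it joins the list.
  ... | no ¬Kv = v , here refl , ¬Kv , simplicial-extend irrefl simp
  ... | yes Kv with All.all? (λ y → E? y v) xs
  -- Here all later vertices are neighbours of `v`, so the whole list is a clique and any vertex
  -- outside `K` will do.
  ...   | yes all = x , x∈ , ¬Kx , complete
    where
    complete : Simplicial E (v ∷ xs) x
    complete (here refl) (here refl) _ _ a≢b = contradiction refl a≢b
    complete (here refl) (there b∈)  _ _ _   = symm (All.lookup all b∈)
    complete (there a∈)  (here refl) _ _ _   = All.lookup all a∈
    complete (there a∈)  (there b∈)  _ _     =
      simp a∈ b∈ (All.lookup all a∈) (All.lookup all b∈)
  ...   | no ¬all
    with y , y∈ , ¬yv ← find (¬All⇒Any¬ (λ y → E? y v) xs ¬all)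
    with s , s∈ , ¬sv , simp-s ← simplicial-outside-clique peo (λ y → E? y v) simp y∈ ¬yv =
    s , there s∈ ,
    (λ Ks → ¬sv (clique (there s∈) (here refl) Ks Kv
                   (λ { refl → v∉ s∈ }))) ,
    simplicial-extend ¬sv simp-s

  module _ {xs : List A} (peo-xs : PEO E xs) where

    open import Data.List.Membership.DecPropositional _≟_ using () renaming (_∈?_ to _∈ₗ?_)

    -- The common vertices form a clique, so some vertex of `ys` outside `xs` is simplicial in `ys`.
    -- By the separation hypothesis its neighbours in the union all lie in `ys`, so it is simplicial
    -- in the union too and may head the new order.
    PEO-glue : ∀ {ys} → PEO E ys →
      (∀ {a b} → a ∈ ys → b ∈ ys → a ∈ xs → b ∈ xs → a ≢ b → E a b) →
      (∀ {a b} → a ∈ ys → a ∉ xs → b ∈ xs → E b a → b ∈ ys) →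
      ∃ λ zs → PEO E zs × (∀ {z} → z ∈ zs → z ∈ xs ⊎ z ∈ ys) ×
               (∀ {z} → z ∈ xs ⊎ z ∈ ys → z ∈ zs)
    PEO-glue {ys} = go ys (<-wellFounded _)
      where
      -- The removed vertex can sit anywhere in `ys`, so the recursion is on the length.
      go : ∀ ys → Acc _<_ (length ys) → PEO E ys →
        (∀ {a b} → a ∈ ys → b ∈ ys → a ∈ xs → b ∈ xs → a ≢ b → E a b) →
        (∀ {a b} → a ∈ ys → a ∉ xs → b ∈ xs → E b a → b ∈ ys) →
        ∃ λ zs → PEO E zs × (∀ {z} → z ∈ zs → z ∈ xs ⊎ z ∈ ys) ×
                 (∀ {z} → z ∈ xs ⊎ z ∈ ys → z ∈ zs)
      go ys (acc rec) peo-ys clique sep with All.all? (_∈ₗ? xs) ys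
      ... | yes ys⊆xs = xs , peo-xs , inj₁ , [ (λ z∈ → z∈) , All.lookup ys⊆xs ]′
      ... | no ys⊈xs
        with y , y∈ , y∉xs ← find (¬All⇒Any¬ (_∈ₗ? xs) ys ys⊈xs)
        with s , s∈ , s∉xs , simp ← simplicial-outside-clique peo-ys (_∈ₗ? xs) clique y∈ y∉xs
        = s ∷ zs , (s∉zs , simp-zs) ∷ peo-zs , fwd , bwd
        where
        ≢s? : Decidable (_≢ s)
        ≢s? y = ¬? (y ≟ s)

        old : ∀ {z} → z ∈ filter ≢s? ys → z ∈ ys
        old = proj₁ ∘ ∈-filter⁻ ≢s?

        IH = go (filter ≢s? ys)
          (rec (filter-notAll ≢s? ys (lose s∈ (λ s≢s → s≢s refl))))
          (PEO-filter ≢s? peo-ys)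
          (λ a∈ b∈ → clique (old a∈) (old b∈))
          -- Separation survives the removal: `b` lies in `xs` and `s` does not, so `b` is not the
          -- vertex removed.
          (λ a∈ a∉ b∈ ba → ∈-filter⁺ ≢s? (sep (old a∈) a∉ b∈ ba) (λ { refl → s∉xs b∈ }))
        zs = proj₁ IH
        peo-zs = proj₁ (proj₂ IH)
        from-zs = proj₁ (proj₂ (proj₂ IH))
        to-zs = proj₂ (proj₂ (proj₂ IH))

        s∉zs : s ∉ zs
        s∉zs s∈zs = [ s∉xs , (λ s∈ys → proj₂ (∈-filter⁻ ≢s? {xs = ys} s∈ys) refl) ]′ (from-zs s∈zs)

        nbr∈ys : ∀ {a} → a ∈ zs → E a s → a ∈ ys
        nbr∈ys a∈ as = [ (λ a∈xs → sep s∈ s∉xs a∈xs as) , old ]′ (from-zs a∈)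

        simp-zs : Simplicial E zs s
        simp-zs a∈ b∈ as bs = simp (nbr∈ys a∈ as) (nbr∈ys b∈ bs) as bs

        fwd : ∀ {z} → z ∈ s ∷ zs → z ∈ xs ⊎ z ∈ ys
        fwd (here refl) = inj₂ s∈
        fwd (there z∈) = [ inj₁ , inj₂ ∘ old ]′ (from-zs z∈)

        bwd : ∀ {z} → z ∈ xs ⊎ z ∈ ys → z ∈ s ∷ zs
        bwd (inj₁ z∈xs) = there (to-zs (inj₁ z∈xs))
        bwd {z} (inj₂ z∈ys) with z ≟ s
        ... | yes refl = here refl
        ... | no z≢s = there (to-zs (inj₂ (∈-filter⁺ ≢s? z∈ys z≢s)))

-- Labelings

module _ (Δ : Complex N) where

  -- Decidability of faces recovers the irrelevant proof.
  vertexFace : (v : Vertex Δ) → Face Δ ⁅ value v ⁆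
  vertexFace (v , [ p ]) = recompute (Face? Δ ⁅ v ⁆) p

  vertex : ∀ {s} → Face Δ s → ∀ {x} → x Subset.∈ s → Vertex Δ
  vertex face {x} x∈s = x , [ Face-closed Δ (⁅⁆⊆ x∈s) face ]

  Adjacent? : Binary.Decidable (Adjacent Δ)
  Adjacent? u v = ¬? (u Fin.≟ v) ×-dec Face? Δ (pair u v)

  Adjacent-sym : ∀ {u v} → Adjacent Δ u v → Adjacent Δ v u
  Adjacent-sym {u} {v} (u≢v , uv) = u≢v ∘ sym , subst (Face Δ) (∪-comm ⁅ u ⁆ ⁅ v ⁆) uv

  -- The labeling is the inverse of the enumeration; the returned equation lets later arguments
  -- trace labels back to points.
  enumeration⇒labeling : (f : Fin n → Fin N) → Injective _≡_ _≡_ f →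
    (∀ i → Face Δ ⁅ f i ⁆) → (∀ {x} → Face Δ ⁅ x ⁆ → ∃ λ i → f i ≡ x) →
    ∃ λ (ℓ : Labeling Δ n) → ∀ v → f (Bijection.to ℓ v) ≡ value v
  enumeration⇒labeling f f-inj f-face f-surj = mk⤖ (inj , surj) , f∘label
    where
    label : Vertex Δ → Fin _
    label v = proj₁ (f-surj (vertexFace v))
    f∘label : ∀ v → f (label v) ≡ value v
    f∘label v = proj₂ (f-surj (vertexFace v))
    inj : Injective _≡_ _≡_ label
    inj {u} {v} eq = value-injective (trans (sym (f∘label u)) (trans (cong f eq) (f∘label v)))
    surj : ∀ i → ∃ λ v → ∀ {u} → u ≡ v → label u ≡ i
    surj i = (f i , [ f-face i ]) , λ { refl → f-inj (f∘label (f i , [ f-face i ])) }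

  module _ (ℓ : Labeling Δ n) where

    open Bijection ℓ using (injective; strictlySurjective) renaming (to to label)

    unlabel : Fin n → Vertex Δ
    unlabel i = proj₁ (strictlySurjective i)

    label-unlabel : ∀ i → label (unlabel i) ≡ i
    label-unlabel i = proj₂ (strictlySurjective i)

    unlabel-label : ∀ v → unlabel (label v) ≡ v
    unlabel-label v = injective (label-unlabel (label v))

    IsMax-pair : ∀ {u v} → label u Fin.< label v → IsMax Δ ℓ (pair (value u) (value v)) (label v)
    IsMax-pair {u} {v} u<v = (v , ∈-pairʳ (value u) (value v) , refl) , bound
      where
      bound : ∀ w → value w Subset.∈ pair (value u) (value v) → label w Fin.≤ label v
      bound w w∈ with ∈-pair⁻ w∈
      ... | inj₁ w≡u = subst (Fin._≤ label v) (cong label (sym (value-injective w≡u))) (ℕ.<⇒≤ u<v)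
      ... | inj₂ w≡v = ℕ.≤-reflexive (cong (toℕ ∘ label) (value-injective w≡v))

    descending : List (Vertex Δ)
    descending = tabulate (unlabel ∘ opposite)

    descending-sorted : AllPairs (λ u v → label v Fin.< label u) descending
    descending-sorted = AllPairs.tabulate⁺-< λ i<j →
      subst₂ Fin._<_ (sym (label-unlabel _)) (sym (label-unlabel _)) (opposite-antitone i<j)

    ∈-descending : ∀ v → v ∈ descending
    ∈-descending v = subst (_∈ descending)
      (trans (cong unlabel (Fin.opposite-involutive (label v))) (unlabel-label v))
      (∈-tabulate⁺ (opposite (label v)))

  -- Two edges from `v` to vertices of smaller label are faces of size 2 with the same maximum, and
  -- their lower ends form a 2-element subset of the union.
  cliqueChordal⇒PEO : SkeletonCliqueChordal Δ →
    ∃ λ xs → PEO (Adjacent Δ) xs × (∀ {x} → x ∈ xs → Face Δ ⁅ x ⁆) × (∀ {x} → Face Δ ⁅ x ⁆ → x ∈ xs)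
  cliqueChordal⇒PEO (n , ℓ , chordal) =
    map value vs , peo (descending-sorted ℓ) ,
    (λ x∈ → case ∈-map⁻ value x∈ of λ { (v , _ , refl) → vertexFace v }) ,
    λ face → ∈-map⁺ value (∈-descending ℓ (_ , [ face ]))
    where
    open Bijection ℓ using () renaming (to to label)
    vs = descending ℓ
    peo : ∀ {us} → AllPairs (λ u v → label v Fin.< label u) us → PEO (Adjacent Δ) (map value us)
    peo [] = []
    peo {v ∷ us} (us<v ∷ sorted) = (v∉ , simp) ∷ peo sorted
      where
      v∉ : value v ∉ map value us
      v∉ v∈ with u , u∈ , eq ← ∈-map⁻ value v∈ =
        ℕ.<-irrefl (cong (toℕ ∘ label) (value-injective (sym eq))) (All.lookup us<v u∈)
      simp : Simplicial (Adjacent Δ) (map value us) (value v)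
      simp a∈ b∈ (a≢v , av) (b≢v , bv) a≢b
        with a , a∈us , refl ← ∈-map⁻ value a∈
        with b , b∈us , refl ← ∈-map⁻ value b∈ =
        a≢b , chordal _ _ av bv
          (λ eq → [ a≢b , a≢v ]′ (∈-pair⁻ (subst (value a Subset.∈_) eq (∈-pairˡ _ (value v)))))
          (trans (∣pair∣≡2 a≢v) (sym (∣pair∣≡2 b≢v)))
          (ℕ.≤-reflexive (sym (∣pair∣≡2 a≢v)))
          (_ , IsMax-pair ℓ (All.lookup us<v a∈us) , IsMax-pair ℓ (All.lookup us<v b∈us))
          _ (pair⊆ (x∈p∪q⁺ (inj₁ (∈-pairˡ _ _))) (x∈p∪q⁺ (inj₂ (∈-pairˡ _ _))))
          (∣pair∣≡2 a≢b)

  -- Faces with the same maximum share the vertex `v` carrying that label. All their other points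
  -- are lower neighbours of `v`, hence pairwise adjacent.
  PEO⇒cliqueChordal : ∀ {xs} → PEO (Adjacent Δ) xs → (∀ {x} → x ∈ xs → Face Δ ⁅ x ⁆) →
    (∀ {x} → Face Δ ⁅ x ⁆ → x ∈ xs) → SkeletonCliqueChordal Δ
  PEO⇒cliqueChordal {xs} peo to-face from-face = length xs , ℓ , chordal
    where
    lookup≢ : ∀ {i j} → i Fin.< j → lookup xs (opposite i) ≢ lookup xs (opposite j)
    lookup≢ i<j = lookup-AllPairs (PEO⇒unique peo) (opposite-antitone i<j) ∘ sym

    labeled : ∃ λ (ℓ : Labeling Δ (length xs)) →
      ∀ v → lookup xs (opposite (Bijection.to ℓ v)) ≡ value v
    -- Reversing the indices gives the head of the list the largest label.
    labeled = enumeration⇒labeling (lookup xs ∘ opposite) (<⇒≢⇒injective lookup≢)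
      (λ i → to-face (∈-lookup (opposite i)))
      (λ face → let i = index (from-face face) in
        opposite i , trans (cong (lookup xs) (Fin.opposite-involutive i))
                           (sym (lookup-index (from-face face))))
    ℓ = proj₁ labeled
    open Bijection ℓ using (injective) renaming (to to label)

    lower-clique : ∀ {u w v} → label u Fin.< label v → label w Fin.< label v →
      Adjacent Δ (value u) (value v) → Adjacent Δ (value w) (value v) →
      value u ≢ value w → Adjacent Δ (value u) (value w)
    lower-clique {u} {w} {v} u<v w<v =
      PEO-lookup peo (proj₂ labeled v) (proj₂ labeled u) (proj₂ labeled w)
        (opposite-antitone u<v) (opposite-antitone w<v)

    -- The closed lower neighbourhood of the first argument.
    Below : Vertex Δ → Vertex Δ → Set
    Below v u = u ≡ v ⊎ label u Fin.< label v × Adjacent Δ (value u) (value v)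

    below-max : ∀ {f m} v → Face Δ f → IsMax Δ ℓ f m → value v Subset.∈ f → label v ≡ m →
      ∀ {x} → x Subset.∈ f → ∃ λ u → value u ≡ x × Below v u
    below-max v face (_ , max) v∈f refl {x} x∈f with x Fin.≟ value v
    ... | yes x≡v = v , sym x≡v , inj₁ refl
    ... | no x≢v = u , refl ,
      inj₂ (ℕ.≤∧≢⇒< (max u x∈f) (x≢v ∘ cong value ∘ injective {u} {v} ∘ Fin.toℕ-injective) ,
            x≢v , Face-closed Δ (pair⊆ x∈f v∈f) face)
      where u = vertex face x∈f

    below-clique : ∀ {u w v} → Below v u → Below v w → value u ≢ value w →
      Face Δ (pair (value u) (value w))
    below-clique (inj₁ refl) (inj₁ refl) u≢w = contradiction refl u≢w
    below-clique (inj₁ refl) (inj₂ (_ , wv)) _ = proj₂ (Adjacent-sym wv)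
    below-clique (inj₂ (_ , uv)) (inj₁ refl) _ = proj₂ uv
    below-clique {u} {w} {v} (inj₂ (u<v , uv)) (inj₂ (w<v , wv)) u≢w =
      proj₂ (lower-clique {u} {w} {v} u<v w<v uv wv u≢w)

    chordal : ∀ f g → Face Δ f → Face Δ g → f ≢ g → ∣ f ∣ ≡ ∣ g ∣ → 2 ≤ ∣ f ∣ →
      SameMax Δ ℓ f g → ∀ h → h Subset.⊆ f Subset.∪ g → ∣ h ∣ ≡ 2 → Face Δ h
    chordal f g face-f face-g _ _ _
      (m , max-f@((v , v∈f , v≡m) , _) , max-g@((v′ , v′∈g , v′≡m) , _)) h h⊆ ∣h∣≡2
      -- The common largest label belongs to a single vertex, which therefore lies in both faces.
      with refl ← injective {v} {v′} (trans v≡m (sym v′≡m))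
      with a , b , a≢b , refl ← ∣p∣≡2⇒p≡pair h ∣h∣≡2
      with below ← (λ {x} x∈h →
             [ below-max v face-f max-f v∈f v≡m {x} , below-max v face-g max-g v′∈g v′≡m {x} ]′
               (x∈p∪q⁻ f g (h⊆ x∈h)))
      with u , refl , u≤v ← below (∈-pairˡ a b)
      with w , refl , w≤v ← below (∈-pairʳ a b) =
      below-clique u≤v w≤v a≢b

-- Gluing complexes along a clique.

glue-cliqueChordal : (Δ Δ₁ Δ₂ : Complex N) → SplitsAs Δ Δ₁ Δ₂ →
  SkeletonCliqueChordal Δ₁ → SkeletonCliqueChordal Δ₂ → SkeletonCliqueChordal Δ
glue-cliqueChordal Δ Δ₁ Δ₂ ((Δ⊆ , ⊆Δ) , _ , _ , _ , complete) chordal₁ chordal₂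
  with xs , peo₁ , faces₁ , all₁ ← cliqueChordal⇒PEO Δ₁ chordal₁
  with ys , peo₂ , faces₂ , all₂ ← cliqueChordal⇒PEO Δ₂ chordal₂ =
  let zs , peo , from-zs , to-zs = Elimination.PEO-glue Fin._≟_ (Adjacent Δ) (Adjacent? Δ)
        (λ (a≢a , _) → a≢a refl) (Adjacent-sym Δ)
        (PEO-resp (λ (a≢b , ab) → a≢b , ⊆Δ (inj₁ ab)) restrict₁ peo₁)
        (PEO-resp (λ (a≢b , ab) → a≢b , ⊆Δ (inj₂ ab)) restrict₂ peo₂)
        (λ a∈ys b∈ys a∈xs b∈xs a≢b →
          let ab , _ = common a∈xs a∈ys b∈xs b∈ys a≢b in a≢b , ⊆Δ (inj₁ ab))
        separated
  in PEO⇒cliqueChordal Δ peo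
       ([ ⊆Δ ∘ inj₁ ∘ faces₁ , ⊆Δ ∘ inj₂ ∘ faces₂ ]′ ∘ from-zs)
       (λ face → to-zs ([ inj₁ ∘ all₁ , inj₂ ∘ all₂ ]′ (Δ⊆ face)))
  where
  common : ∀ {a b} → a ∈ xs → a ∈ ys → b ∈ xs → b ∈ ys → a ≢ b →
    Face Δ₁ (pair a b) × Face Δ₂ (pair a b)
  common {a} {b} a∈xs a∈ys b∈xs b∈ys a≢b =
    proj₁ (proj₂ (complete (v a∈xs a∈ys) (v b∈xs b∈ys) (a≢b ∘ cong value)))
    where
    v : ∀ {x} → x ∈ xs → x ∈ ys → Vertex (skeleton 1 (Δ₁ ∩ Δ₂))
    v {x} x∈xs x∈ys = x , [ (faces₁ x∈xs , faces₂ x∈ys) ,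
                            ℕ.≤-trans (ℕ.≤-reflexive (∣⁅x⁆∣≡1 x)) (s≤s z≤n) ]

  endˡ : ∀ (Γ : Complex _) {a b} → Face Γ (pair a b) → Face Γ ⁅ a ⁆
  endˡ Γ = Face-closed Γ (⁅⁆⊆ (∈-pairˡ _ _))

  endʳ : ∀ (Γ : Complex _) {a b} → Face Γ (pair a b) → Face Γ ⁅ b ⁆
  endʳ Γ {a} = Face-closed Γ (⁅⁆⊆ (∈-pairʳ a _))

  -- If the edge comes from `Δ₂`, both ends are common vertices, and these are already joined in the
  -- intersection.
  restrict₁ : ∀ {a b} → a ∈ xs → b ∈ xs → Adjacent Δ a b → Adjacent Δ₁ a b
  restrict₁ a∈ b∈ (a≢b , ab) = a≢b , [ (λ p → p) ,
    (λ p → proj₁ (common a∈ (all₂ (endˡ Δ₂ p)) b∈ (all₂ (endʳ Δ₂ p)) a≢b)) ]′ (Δ⊆ ab)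

  restrict₂ : ∀ {a b} → a ∈ ys → b ∈ ys → Adjacent Δ a b → Adjacent Δ₂ a b
  restrict₂ a∈ b∈ (a≢b , ab) = a≢b , [
    (λ p → proj₂ (common (all₁ (endˡ Δ₁ p)) a∈ (all₁ (endʳ Δ₁ p)) b∈ a≢b)) , (λ p → p) ]′ (Δ⊆ ab)

  -- The edge is a face of `Δ₁` or of `Δ₂`, and the former would make `a` a vertex of `Δ₁`.
  separated : ∀ {a b} → a ∈ ys → a ∉ xs → b ∈ xs → Adjacent Δ b a → b ∈ ys
  separated _ a∉xs _ (_ , ba) =
    [ (λ p → contradiction (all₁ (endʳ Δ₁ p)) a∉xs) , all₂ ∘ endˡ Δ₂ ]′ (Δ⊆ ba)

-- Induced subcomplexes and splitting at the last vertex.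

module _ (Δ : Complex N) where

  -- The surviving vertices are renumbered in the same order, so faces keep their maximal vertex. A
  -- subset of the union of two induced faces still has all its points in `P`.
  induced-EChordal : {P : Pred (Fin N) 0ℓ} (P? : Decidable P) →
    SkeletonEChordal Δ → SkeletonEChordal (induced Δ P?)
  induced-EChordal {P} P? (n , ℓ , chordal) = length vs , ℓ′ , chordal′
    where
    open Bijection ℓ using () renaming (to to label)
    Γ = induced Δ P?

    vs : List (Vertex Δ)
    vs = filter (P? ∘ value) (descending Δ ℓ)

    vs-sorted : AllPairs (λ u v → label v Fin.< label u) vs
    vs-sorted = AllPairs.filter⁺ (P? ∘ value) (descending-sorted Δ ℓ)

    opposite-sorted : ∀ {i j} → i Fin.< j →
      label (lookup vs (opposite i)) Fin.< label (lookup vs (opposite j))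
    opposite-sorted i<j = lookup-AllPairs vs-sorted (opposite-antitone i<j)

    enumerate : ∀ {x} → Face Γ ⁅ x ⁆ → ∃ λ i → value (lookup vs (opposite i)) ≡ x
    enumerate {x} (face , lift) =
      opposite (index x∈vs) ,
      cong value (trans (cong (lookup vs) (Fin.opposite-involutive (index x∈vs)))
                        (sym (lookup-index x∈vs)))
      where
      x∈vs : (x , [ face ]) ∈ vs
      x∈vs = ∈-filter⁺ (P? ∘ value) (∈-descending Δ ℓ _) (lift (x∈⁅x⁆ x))

    labeled : ∃ λ (ℓ′ : Labeling Γ (length vs)) →
      ∀ v → value (lookup vs (opposite (Bijection.to ℓ′ v))) ≡ value v
    labeled = enumeration⇒labeling Γ (value ∘ lookup vs ∘ opposite)
      (<⇒≢⇒injective λ i<j eq →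
        ℕ.<-irrefl (cong (toℕ ∘ label) (value-injective eq)) (opposite-sorted i<j))
      (λ i → let v = lookup vs (opposite i) in
        vertexFace Δ v ,
        λ x∈ → subst P (sym (x∈⁅y⁆⇒x≡y _ x∈))
                 (proj₂ (∈-filter⁻ (P? ∘ value) {xs = descending Δ ℓ} (∈-lookup (opposite i)))))
      enumerate
    ℓ′ = proj₁ labeled
    open Bijection ℓ′ using () renaming (to to label′)

    include : Vertex Γ → Vertex Δ
    include v = value v , [ proj₁ (vertexFace Γ v) ]

    lookup-label′ : ∀ v → lookup vs (opposite (label′ v)) ≡ include v
    lookup-label′ v = value-injective (proj₂ labeled v)

    label-mono : ∀ u v → label′ u Fin.≤ label′ v → label (include u) Fin.≤ label (include v)
    label-mono u v u≤v with ℕ.m≤n⇒m<n∨m≡n u≤v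
    ... | inj₁ u<v = ℕ.<⇒≤ (subst₂ (λ x y → label x Fin.< label y)
                              (lookup-label′ u) (lookup-label′ v) (opposite-sorted u<v))
    ... | inj₂ u≡v = ℕ.≤-reflexive (cong (toℕ ∘ label ∘ include)
                       (Bijection.injective ℓ′ {u} {v} (Fin.toℕ-injective u≡v)))

    isMax : ∀ {f} v → Face Γ f → value v Subset.∈ f → IsMax Γ ℓ′ f (label′ v) →
      IsMax Δ ℓ f (label (include v))
    isMax v face v∈f (_ , max) =
      (include v , v∈f , refl) ,
      λ u u∈f → label-mono (vertex Γ face u∈f) v (max (vertex Γ face u∈f) u∈f)

    chordal′ : ∀ f g → Face Γ f → Face Γ g → f ≢ g → ∣ f ∣ ≡ ∣ g ∣ → SameMax Γ ℓ′ f g →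
      ∀ h → h Subset.⊆ f Subset.∪ g → ∣ h ∣ ≡ ∣ f ∣ → Face Γ h
    chordal′ f g face-f face-g f≢g ∣f∣≡∣g∣
      (m , max-f@((v , v∈f , refl) , _) , max-g@((v′ , v′∈g , v′≡v) , _)) h h⊆ ∣h∣≡∣f∣
      with refl ← Bijection.injective ℓ′ {v′} {v} v′≡v =
      chordal f g (proj₁ face-f) (proj₁ face-g) f≢g ∣f∣≡∣g∣
        (_ , isMax v face-f v∈f max-f , isMax v face-g v′∈g max-g) h h⊆ ∣h∣≡∣f∣ ,
      λ x∈h → [ proj₂ face-f , proj₂ face-g ]′ (x∈p∪q⁻ f g (h⊆ x∈h))

  -- The given vertex rules out an empty set of labels.
  lastVertex : (ℓ : Labeling Δ n) → Vertex Δ →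
    ∃ λ v → ∀ u → Bijection.to ℓ u Fin.≤ Bijection.to ℓ v
  lastVertex {zero} ℓ v₀ with () ← Bijection.to ℓ v₀
  lastVertex {suc n} ℓ v₀ = unlabel Δ ℓ (fromℕ n) ,
    λ u → subst (Bijection.to ℓ u Fin.≤_) (sym (label-unlabel Δ ℓ (fromℕ n))) (Fin.≤fromℕ _)

  -- This unfolds to the decision procedure inside `neighbourhood`, so inducing on it yields the
  -- neighbourhood definitionally.
  near? : (v : Vertex Δ) → Decidable (λ x → x ≡ value v ⊎ Adjacent Δ x (value v))
  near? v x = (x Fin.≟ value v) ⊎-dec Adjacent? Δ x (value v)

  EChordal⇒neighbourhood⊎splits : Vertex Δ → SkeletonEChordal Δ →
    (∃ λ (v : Vertex Δ) → Δ ≈ neighbourhood Δ v) ⊎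
    (∃ λ (Δ₁ : Complex N) → ∃ λ (Δ₂ : Complex N) →
      SplitsAs Δ Δ₁ Δ₂ × SkeletonEChordal Δ₁ × SkeletonEChordal Δ₂)
  EChordal⇒neighbourhood⊎splits v₀ chordal@(n , ℓ , exchange)
    with v , last ← lastVertex ℓ v₀
    -- The neighbourhood of `v` is all of `Δ` exactly when every vertex is near `v`; otherwise it is
    -- proper and can serve as a part of the splitting.
    with Fin.all? (λ x → Face? Δ ⁅ x ⁆ →-dec near? v x)
  ... | yes all = inj₁ (v ,
          (λ face → face , λ x∈s → all _ (Face-closed Δ (⁅⁆⊆ x∈s) face)) , proj₁)
  ... | no ¬all = inj₂ (Δ-v , neighbourhood Δ v ,
          ((cover , [ proj₁ , proj₁ ]′) ,
           -- The first part misses the vertex `v`; were the second part everything, every vertex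
           -- would be near `v`.
           (proj₁ , λ Δ⊆ → proj₂ (Δ⊆ (vertexFace Δ v)) (x∈⁅x⁆ _) refl) ,
           (proj₁ , λ Δ⊆ → ¬all (λ x face → proj₂ (Δ⊆ face) (x∈⁅x⁆ x))) ,
           (λ s → proj₂) , complete) ,
          induced-EChordal ≢v? chordal , induced-EChordal (near? v) chordal)
    where
    open Bijection ℓ using (injective) renaming (to to label)
    ≢v? : Decidable (_≢ value v)
    ≢v? x = ¬? (x Fin.≟ value v)

    Δ-v = induced Δ ≢v?

    cover : ∀ {s} → Face Δ s → Face (Δ-v ∪ neighbourhood Δ v) s
    cover {s} face with value v ∈? s
    ... | no v∉s = inj₁ (face , λ { x∈s refl → v∉s x∈s })
    ... | yes v∈s = inj₂ (face , near)
      where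
      near : ∀ {x} → x Subset.∈ s → x ≡ value v ⊎ Adjacent Δ x (value v)
      near {x} x∈s with x Fin.≟ value v
      ... | yes x≡v = inj₁ x≡v
      ... | no x≢v = inj₂ (x≢v , Face-closed Δ (pair⊆ x∈s v∈s) face)

    Γ = skeleton 1 (Δ-v ∩ neighbourhood Δ v)

    complete : ∀ (a b : Vertex Γ) → a ≢ b → Adjacent Γ (value a) (value b)
    complete a b a≢b
      with ((Fa , a≢v) , (_ , na)) , _ ← vertexFace Γ a
      with ((Fb , b≢v) , (_ , nb)) , _ ← vertexFace Γ b
      with na (x∈⁅x⁆ _) | nb (x∈⁅x⁆ _)
    ... | inj₁ a≡v | _ = ⊥-elim (a≢v (x∈⁅x⁆ _) a≡v)
    ... | inj₂ _ | inj₁ b≡v = ⊥-elim (b≢v (x∈⁅x⁆ _) b≡v)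
    ... | inj₂ (a≢v′ , av) | inj₂ (b≢v′ , bv) =
      va≢vb ,
      ((ab , lift a≢v b≢v) , (ab , lift na nb)) ,
      ℕ.≤-reflexive (∣pair∣≡2 va≢vb)
      where
      va≢vb : value a ≢ value b
      va≢vb = a≢b ∘ value-injective

      lift : ∀ {Q : Pred (Fin N) 0ℓ} → Subset.Lift Q ⁅ value a ⁆ → Subset.Lift Q ⁅ value b ⁆ →
        Subset.Lift Q (pair (value a) (value b))
      lift qa qb x∈ = [ qa , qb ]′ (x∈p∪q⁻ ⁅ value a ⁆ ⁅ value b ⁆ x∈)

      below : ∀ u → value u ≢ value v → label u Fin.< label v
      below u u≢v =
        ℕ.≤∧≢⇒< (last u) (u≢v ∘ cong value ∘ injective ∘ Fin.toℕ-injective)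

      ab : Face Δ (pair (value a) (value b))
      ab = exchange _ _ av bv
        (λ eq → [ va≢vb , a≢v′ ]′
          (∈-pair⁻ (subst (value a Subset.∈_) eq (∈-pairˡ _ (value v)))))
        (trans (∣pair∣≡2 a≢v′) (sym (∣pair∣≡2 b≢v′)))
        (_ , IsMax-pair Δ ℓ (below (value a , [ Fa ]) a≢v′)
           , IsMax-pair Δ ℓ (below (value b , [ Fb ]) b≢v′))
        _ (pair⊆ (x∈p∪q⁺ (inj₁ (∈-pairˡ _ _))) (x∈p∪q⁺ (inj₂ (∈-pairˡ _ _))))
        (trans (∣pair∣≡2 va≢vb) (sym (∣pair∣≡2 a≢v′)))

theorem116 : ∀ {N d : ℕ} (Δ : Complex N) → HasDimension Δ d →
    (SkeletonEChordal Δ →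
    (∃ λ (v : Vertex Δ) → Δ ≈ neighbourhood Δ v) ⊎
    (∃ λ (Δ₁ : Complex N) → ∃ λ (Δ₂ : Complex N) →
    SplitsAs Δ Δ₁ Δ₂ × SkeletonEChordal Δ₁ × SkeletonEChordal Δ₂))
    ×
    (∀ (Δ₁ Δ₂ : Complex N) →
    SplitsAs Δ Δ₁ Δ₂ → SkeletonCliqueChordal Δ₁ → SkeletonCliqueChordal Δ₂ →
    SkeletonCliqueChordal Δ)
theorem116 Δ ((s , face , ∣s∣≡1+d) , _) =
  -- A face of size `suc d` is nonempty and supplies a vertex, so a last vertex exists.
  EChordal⇒neighbourhood⊎splits Δ (vertex Δ face (proj₂ (member s 1≤∣s∣))) ,
  glue-cliqueChordal Δ
  where
  1≤∣s∣ : 1 ≤ ∣ s ∣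
  1≤∣s∣ = subst (1 ≤_) (sym ∣s∣≡1+d) (s≤s z≤n)
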